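{- For every formula $A$ of $\mathbf{L_1}$ the following are equivalent: (i) $\vdash_T A$; (ii) $\vdash_H A$; (iii) $TA$ is valid in first-order predicate logic with equality; (iv) it is not the case that $\dashv_H A$.
   Context: Formulas of $\mathbf{L_1}$: built from atomic formulas $\epsilon ab$, where $a,b$ range over a countably infinite list of name variables (possibly equal), using the primitive connectives $\vee$ and $\sim$; $\wedge,\supset,\equiv$ are defined from these as usual. Disjunctions $A_1\vee\cdots\vee A_n$ may be associated in any way. Hilbert-type $\mathbf{L_1}$: $\vdash_H A$ means $A$ belongs to the smallest set of formulas of $\mathbf{L_1}$ containing all instances of classical propositional tautologies and all formulas $\epsilon ab\supset\epsilon aa$, $(\epsilon ab\wedge\epsilon bc)\supset\epsilon ac$, $(\epsilon ab\wedge\epsilon bb)\supset\epsilon ba$ (for arbitrary name variables $a,b,c$), and closed under modus ponens. Positive/negative parts (occurrences of subformulas): $A$ is a positive part of $A$; if $B\vee C$ is a positive part of $A$ then $B$ and $C$ are positive parts of $A$; if $\sim B$ is a positive part of $A$ then $B$ is a negative part of $A$; if $\sim B$ is a negative part of $A$ then $B$ is a positive part of $A$. $F[B_+]$ (resp. $G[B_-]$) denotes a formula with a specified occurrence of $B$ as a positive (resp. negative) part; $F[B_+,C_-]$, $G[B_-,C_-]$ etc. denote formulas with specified non-overlapping such occurrences. Tableaux: the reduction rules are ($\vee_-$) from $G[B\vee C_-]$ produce two branches $G[B\vee C_-]\vee\sim B$ and $G[B\vee C_-]\vee\sim C$; ($\epsilon_1$) from $G[\epsilon ab_-]$ produce $G[\epsilon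 ab_-]\vee\sim\epsilon aa$; ($\epsilon_2$) from $G[\epsilon ab_-,\epsilon bc_-]$ produce $G[\epsilon ab_-,\epsilon bc_-]\vee\sim\epsilon ac$; ($\epsilon_{3b}$) from $G[\epsilon ab_-,\epsilon bb_-]$ produce $G[\epsilon ab_-,\epsilon bb_-]\vee\sim\epsilon ba$. A tableau for $A$ is a finite tree of formulas with root $A$ in which the children of each non-leaf node are obtained from it by one reduction rule. A branch is closed if its last formula has the form $F[B_+,B_-]$ (some formula $B$ has one occurrence as a positive part and another as a negative part); a tableau is closed if all its branches are closed. $\vdash_T A$ means that $A$ has a closed tableau. Hintikka formula: a formula $H$ such that (1) $H$ is not of the form $F[B_+,B_-]$; (2) if $B\vee C$ is a negative part of $H$ then $B$ or $C$ is a negative part of $H$; (3) if $\epsilon ab$ is a negative part of $H$ then so is $\epsilon aa$; (4) if $\epsilon ab$ and $\epsilon bc$ are negative parts of $H$ then so is $\epsilon ac$; (5) if $\epsilon ab$ and $\epsilon bb$ are negative parts of $H$ then so is $\epsilon ba$. Hilbert-type axiomatic rejection $\mathbf{HAR}$: fix a name variable $a_0$. $\dashv_H$ is the smallest set of formulas such that: $\dashv_H\epsilon a_0a_0$; $\dashv_H\sim\epsilon a_0a_0$; if $\vdash_H A\supset B$ and $\dashv_H B$ then $\dashv_H A$; if $\dashv_H A$ and $A$ is obtained from $B$ by a uniform substitution of name variables for name variables, then $\dashv_H B$; if $A$ is a Hintikka formula which is a disjunction all of whose disjuncts are atomic or negated atomic formulas, $\dashv_H A$, and $\epsilon ab$ does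 not occur in $A$ as a negative part, then $\dashv_H A\vee\epsilon ab$. Translation $T$ into first-order logic with equality, with a monadic predicate $F_a$ for each name variable $a$: $T\epsilon ab=\exists x(F_ax\wedge F_bx)\wedge\forall x\forall y(F_ax\wedge F_ay\supset x=y)$; $T(A\vee B)=TA\vee TB$; $T(\sim A)=\sim TA$. "Valid in first-order predicate logic with equality" means true in every first-order structure (nonempty domain, $=$ interpreted as identity, arbitrary interpretation of the $F_a$). -}

module Defs where

open import Level using (Level) renaming (suc to lsuc)
open import Data.Bool.Base as Bool using (Bool; true)
open import Data.Fin.Base using (Fin; zero; suc)
open import Data.Nat.Base using (ℕ; suc)
open import Data.Product.Base using (Σ; ∃; ∃-syntax; _×_; _,_)
open import Data.Sum.Base using (_⊎_)
open import Data.Vec.Base using (Vec; []; _∷_; lookup)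
open import Relation.Binary.PropositionalEquality.Core using (_≡_)
open import Relation.Nullary.Negation.Core using (¬_)

infix  8 ∼_
infixr 7 _∧_
infixr 6 _∨_
infixr 5 _⊃_

data Form (X : Set) : Set where
  atom : X → Form X
  _∨_  : Form X → Form X → Form X
  ∼_   : Form X → Form X

_∧_ : ∀ {X} → Form X → Form X → Form X
A ∧ B = ∼ (∼ A ∨ ∼ B)

_⊃_ : ∀ {X} → Form X → Form X → Form X
A ⊃ B = ∼ A ∨ B

_⟪_⟫ : ∀ {X Y} → Form X → (X → Form Y) → Form Y
atom x  ⟪ σ ⟫ = σ x
(A ∨ B) ⟪ σ ⟫ = (A ⟪ σ ⟫) ∨ (B ⟪ σ ⟫)
(∼ A)   ⟪ σ ⟫ = ∼ (A ⟪ σ ⟫)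

Name : Set
Name = ℕ

Formula : Set
Formula = Form (Name × Name)

pattern ε a b = atom (a , b)

rename : (Name → Name) → Formula → Formula
rename σ A = A ⟪ (λ { (a , b) → ε (σ a) (σ b) }) ⟫

PropFormula : Set
PropFormula = Form ℕ

eval : (ℕ → Bool) → PropFormula → Bool
eval v (atom p) = v p
eval v (P ∨ Q)  = eval v P Bool.∨ eval v Q
eval v (∼ P)    = Bool.not (eval v P)

Tautology : PropFormula → Set
Tautology P = ∀ v → eval v P ≡ true

infix 3 ⊢H_

data ⊢H_ : Formula → Set where
  taut : ∀ P (σ : ℕ → Formula) → Tautology P → ⊢H P ⟪ σ ⟫
  ax₁  : ∀ a b → ⊢H ε a b ⊃ ε a a
  ax₂  : ∀ a b c → ⊢H (ε a b ∧ ε b c) ⊃ ε a c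
  ax₃  : ∀ a b → ⊢H (ε a b ∧ ε b b) ⊃ ε b a
  mp   : ∀ {A B} → ⊢H A ⊃ B → ⊢H A → ⊢H B

data Sign : Set where
  + - : Sign

-- An element of Part s A B is an occurrence of B in A as a positive
-- (s = +) or negative (s = -) part, given by the path from the root.
data Part : Sign → Formula → Formula → Set where
  root : ∀ {A} → Part + A A
  ∨ˡ   : ∀ {A B C} → Part + A (B ∨ C) → Part + A B
  ∨ʳ   : ∀ {A B C} → Part + A (B ∨ C) → Part + A C
  ∼⁺   : ∀ {A B} → Part + A (∼ B) → Part - A B
  ∼⁻   : ∀ {A B} → Part - A (∼ B) → Part + A B

infix 4 _⊒_

-- p ⊒ q : the occurrence q lies inside (or equals) the occurrence p.
data _⊒_ {A : Formula} {s B} (p : Part s A B) : ∀ {t C} → Part t A C → Set where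
  ⊒-refl : p ⊒ p
  ⊒-∨ˡ   : ∀ {C D} {q : Part + A (C ∨ D)} → p ⊒ q → p ⊒ ∨ˡ q
  ⊒-∨ʳ   : ∀ {C D} {q : Part + A (C ∨ D)} → p ⊒ q → p ⊒ ∨ʳ q
  ⊒-∼⁺   : ∀ {C} {q : Part + A (∼ C)} → p ⊒ q → p ⊒ ∼⁺ q
  ⊒-∼⁻   : ∀ {C} {q : Part - A (∼ C)} → p ⊒ q → p ⊒ ∼⁻ q

NonOverlapping : ∀ {A s t B C} → Part s A B → Part t A C → Set
NonOverlapping p q = ¬ (p ⊒ q) × ¬ (q ⊒ p)

-- A has the form F[B₊,B₋].  Two occurrences of the same formula with
-- opposite signs never overlap, so no such condition is imposed.
Clash : Formula → Set
Clash A = ∃[ B ] Part + A B × Part - A B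

data Tableau (G : Formula) : Set where
  leaf : Tableau G
  ∨₋   : ∀ {B C} → Part - G (B ∨ C) →
         Tableau (G ∨ ∼ B) → Tableau (G ∨ ∼ C) → Tableau G
  ε₁   : ∀ {a b} → Part - G (ε a b) →
         Tableau (G ∨ ∼ ε a a) → Tableau G
  ε₂   : ∀ {a b c} (p : Part - G (ε a b)) (q : Part - G (ε b c)) →
         NonOverlapping p q →
         Tableau (G ∨ ∼ ε a c) → Tableau G
  ε₃b  : ∀ {a b} (p : Part - G (ε a b)) (q : Part - G (ε b b)) →
         NonOverlapping p q →
         Tableau (G ∨ ∼ ε b a) → Tableau G

Closed : ∀ {G} → Tableau G → Set
Closed {G} leaf       = Clash G
Closed (∨₋ _ t u)     = Closed t × Closed u
Closed (ε₁ _ t)       = Closed t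
Closed (ε₂ _ _ _ t)   = Closed t
Closed (ε₃b _ _ _ t)  = Closed t

infix 3 ⊢T_

⊢T_ : Formula → Set
⊢T A = Σ (Tableau A) Closed

record Hintikka (H : Formula) : Set where
  field
    no-clash : ¬ Clash H
    ∨-neg    : ∀ {B C} → Part - H (B ∨ C) → Part - H B ⊎ Part - H C
    ε-refl   : ∀ {a b} → Part - H (ε a b) → Part - H (ε a a)
    ε-trans  : ∀ {a b c} → Part - H (ε a b) → Part - H (ε b c) → Part - H (ε a c)
    ε-sym    : ∀ {a b} → Part - H (ε a b) → Part - H (ε b b) → Part - H (ε b a)

data LiteralDisjunction : Formula → Set where
  pos : ∀ {a b} → LiteralDisjunction (ε a b)
  neg : ∀ {a b} → LiteralDisjunction (∼ ε a b)
  _∨_ : ∀ {A B} → LiteralDisjunction A → LiteralDisjunction B →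
        LiteralDisjunction (A ∨ B)

infix 3 _⊣H_

-- a₀ ⊣H A : A is rejected in HAR with a₀ as the fixed name variable.
data _⊣H_ (a₀ : Name) : Formula → Set where
  rej⁺  : a₀ ⊣H ε a₀ a₀
  rej⁻  : a₀ ⊣H ∼ ε a₀ a₀
  rej-⊃ : ∀ {A B} → ⊢H A ⊃ B → a₀ ⊣H B → a₀ ⊣H A
  rej-σ : ∀ {B} (σ : Name → Name) → a₀ ⊣H rename σ B → a₀ ⊣H B
  rej-∨ : ∀ {A a b} → Hintikka A → LiteralDisjunction A → a₀ ⊣H A →
          ¬ Part - A (ε a b) → a₀ ⊣H A ∨ ε a b

infix  9 _≐_
infix  8 ∼ᶠ_ ∃ᶠ_ ∀ᶠ_
infixr 7 _∧ᶠ_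
infixr 6 _∨ᶠ_
infixr 5 _⊃ᶠ_

-- FO n : formulas with free variables among n de Bruijn indices
-- (index 0 is bound by the innermost quantifier).
data FO (n : ℕ) : Set where
  F              : Name → Fin n → FO n
  _≐_            : Fin n → Fin n → FO n
  _∧ᶠ_ _∨ᶠ_ _⊃ᶠ_ : FO n → FO n → FO n
  ∼ᶠ_            : FO n → FO n
  ∃ᶠ_ ∀ᶠ_        : FO (suc n) → FO n

T : Formula → FO 0
T (ε a b) =
  (∃ᶠ (F a zero ∧ᶠ F b zero)) ∧ᶠ
  (∀ᶠ ∀ᶠ (F a (suc zero) ∧ᶠ F a zero ⊃ᶠ suc zero ≐ zero))
T (A ∨ B) = T A ∨ᶠ T B
T (∼ A)   = ∼ᶠ T A

record Structure (ℓ : Level) : Set (lsuc ℓ) where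
  field
    Domain   : Set ℓ
    nonempty : Domain
    ⟦F_⟧     : Name → Domain → Set ℓ

module _ {ℓ} (M : Structure ℓ) where
  open Structure M

  Sat : ∀ {n} → Vec Domain n → FO n → Set ℓ
  Sat ρ (F a x)  = ⟦F a ⟧ (lookup ρ x)
  Sat ρ (x ≐ y)  = lookup ρ x ≡ lookup ρ y
  Sat ρ (φ ∧ᶠ ψ) = Sat ρ φ × Sat ρ ψ
  Sat ρ (φ ∨ᶠ ψ) = Sat ρ φ ⊎ Sat ρ ψ
  Sat ρ (φ ⊃ᶠ ψ) = Sat ρ φ → Sat ρ ψ
  Sat ρ (∼ᶠ φ)   = ¬ Sat ρ φ
  Sat ρ (∃ᶠ φ)   = ∃ λ d → Sat (d ∷ ρ) φ
  Sat ρ (∀ᶠ φ)   = ∀ d → Sat (d ∷ ρ) φ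

-- Truth in a structure is meant classically.  Since Sat takes values in
-- types, this is expressed by the outer double negation, which classical
-- logic removes; without it T (A ∨ ∼ A) would not be provably valid.
Valid : ∀ ℓ → FO 0 → Set (lsuc ℓ)
Valid ℓ φ = (M : Structure ℓ) → ¬ ¬ Sat M [] φ

{-# OPTIONS --safe #-}

-- Everything is compared with Boolean valuations v of the atoms ε a b whose
-- set of true atoms is closed under the three ε-rules.  A systematic tableau
-- for A either closes or yields a finite closed set N of atoms such that "true
-- exactly on N" falsifies A.  Such a valuation is realised by a first-order
-- structure, whose individuals are the least representatives of the classes of
-- names a with ε a a, together with two extra objects falling under every name
-- b with ∼ ε b b (so that F_b is then not a singleton).  It also yields a
-- rejection of A: A implies the disjunction of all ∼ ε a b for ε a b in N and
-- all atoms of A outside N, and this disjunction is rejected by adding its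
-- positive disjuncts one at a time.
module Submission where

open import Level using (Level; Lift; lift)
open import Data.Bool.Base as Bool using (Bool; true; false; not)
open import Data.Bool.Properties using (¬-not; not-injective) renaming (_≟_ to _≟ᵇ_)
open import Data.Empty using (⊥; ⊥-elim)
open import Data.List.Base using (List; []; _∷_; _++_; [_]; length; map; cartesianProduct; filter)
open import Data.List.Membership.DecPropositional using () renaming (_∈?_ to mem?)
open import Data.List.Membership.Propositional using (_∈_; _∉_)
open import Data.List.Membership.Propositional.Properties using (∈-∃++; ∈-++⁺ˡ; ∈-++⁺ʳ; ∈-++⁻; ∈-map⁺; ∈-cartesianProduct⁺; ∈-filter⁺; ∈-filter⁻)
open import Data.List.Properties using (length-++; ++-identityʳ)
open import Data.List.Relation.Binary.Subset.Propositional using (_⊆_)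
open import Data.List.Relation.Unary.All as All using (All; []; _∷_)
open import Data.List.Relation.Unary.Any using (here; there)
open import Data.Nat.Base as ℕ using (ℕ; zero; suc; _<_)
open import Data.Nat.Induction using (<-rec)
open import Data.Nat.Properties using (_≟_; <-cmp; anyUpTo?; +-suc; +-identityʳ; suc-injective)
open import Data.Product.Base using (∃; ∃-syntax; _×_; _,_; proj₁; proj₂)
open import Data.Product.Properties using (≡-dec)
open import Data.Sum.Base using (_⊎_; inj₁; inj₂; [_,_]′)
open import Data.Vec.Base using ([])
open import Function.Base using (_∘_; const)
open import Function.Bundles using (_⇔_; mk⇔)
open import Relation.Binary.Definitions using (tri<; tri≈; tri>)
open import Relation.Binary.PropositionalEquality.Core using (_≡_; refl; sym; trans; cong; cong₂; subst)
open import Relation.Nullary.Decidable.Core using (Dec; yes; no; does; ¬?)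
open import Relation.Nullary.Negation.Core using (¬_)
open import Defs

-- Boolean valuations of the atoms.

Atom : Set
Atom = Name × Name

Valuation : Set
Valuation = Atom → Bool

value : ∀ {X} → (X → Bool) → Form X → Bool
value v (atom x) = v x
value v (A ∨ B)  = value v A Bool.∨ value v B
value v (∼ A)    = not (value v A)

infix 4 _⊨_

_⊨_ : Valuation → Formula → Set
v ⊨ A = value v A ≡ true

-- Taken for an arbitrary predicate, so that it serves both valuations and membership in a finite
-- list.
record εClosed (R : Atom → Set) : Set where
  field
    ε-refl  : ∀ {a b} → R (a , b) → R (a , a)
    ε-trans : ∀ {a b c} → R (a , b) → R (b , c) → R (a , c)
    ε-sym   : ∀ {a b} → R (a , b) → R (b , b) → R (b , a)

IsModel : Valuation → Set
IsModel v = εClosed (λ x → v x ≡ true)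

atoms : Formula → List Atom
atoms (atom x) = [ x ]
atoms (A ∨ B)  = atoms A ++ atoms B
atoms (∼ A)    = atoms A

value-cong : ∀ {v w} A → (∀ {x} → x ∈ atoms A → v x ≡ w x) → value v A ≡ value w A
value-cong (atom x) h = h (here refl)
value-cong (A ∨ B)  h = cong₂ Bool._∨_ (value-cong A (h ∘ ∈-++⁺ˡ)) (value-cong B (h ∘ ∈-++⁺ʳ (atoms A)))
value-cong (∼ A)    h = cong not (value-cong A h)

value-⟪⟫ : ∀ {X Y} (v : Y → Bool) (σ : X → Form Y) A → value v (A ⟪ σ ⟫) ≡ value (value v ∘ σ) A
value-⟪⟫ v σ (atom x) = refl
value-⟪⟫ v σ (A ∨ B)  = cong₂ Bool._∨_ (value-⟪⟫ v σ A) (value-⟪⟫ v σ B)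
value-⟪⟫ v σ (∼ A)    = cong not (value-⟪⟫ v σ A)

eval≡value : ∀ v P → eval v P ≡ value v P
eval≡value v (atom p) = refl
eval≡value v (P ∨ Q)  = cong₂ Bool._∨_ (eval≡value v P) (eval≡value v Q)
eval≡value v (∼ P)    = cong not (eval≡value v P)

⊨-⊃ : ∀ v A B → (v ⊨ A → v ⊨ B) → v ⊨ A ⊃ B
⊨-⊃ v A B h with value v A
... | true  = h refl
... | false = refl

⊨-mp : ∀ v A B → v ⊨ A ⊃ B → v ⊨ A → v ⊨ B
⊨-mp v A B h k rewrite k = h

⊭-⊃ : ∀ v A B → v ⊨ A ⊃ B → value v B ≡ false → value v A ≡ false
⊭-⊃ v A B h k with value v A
... | false = refl
... | true  = trans (sym h) k

∨-false : ∀ {b c} → b Bool.∨ c ≡ false → b ≡ false × c ≡ false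
∨-false {false} h = refl , h

∨-true : ∀ {b c} → b Bool.∨ c ≡ true → b ≡ true ⊎ c ≡ true
∨-true {true}  h = inj₁ refl
∨-true {false} h = inj₂ h

∨-trueʳ : ∀ {b c} → c ≡ true → b Bool.∨ c ≡ true
∨-trueʳ {true}  h = refl
∨-trueʳ {false} h = h

true≢false : ∀ {b} → b ≡ true → b ≡ false → ⊥
true≢false refl ()

-- The Hilbert system proves every tautology in the atoms ε a b

step : Atom → Atom
step (zero  , b) = suc b , zero
step (suc a , b) = a , suc b

enumerate : ℕ → Atom
enumerate zero    = zero , zero
enumerate (suc n) = step (enumerate n)

-- `step` walks the antidiagonals, on each of which a + b is constant, and here the walk is traced
-- backwards: (a, suc b) comes from (suc a, b) on the same antidiagonal, (suc a, 0) from (0, a) on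
-- the previous one. The recursion is lexicographic in s and b.
enumerate-onto : ∀ s a b → a ℕ.+ b ≡ s → ∃[ n ] enumerate n ≡ (a , b)
enumerate-onto s zero zero _ = 0 , refl
enumerate-onto s a (suc b) eq with enumerate-onto s (suc a) b (trans (sym (+-suc a b)) eq)
... | n , h = suc n , cong step h
enumerate-onto (suc s) (suc a) zero eq
  with enumerate-onto s zero a (trans (sym (+-identityʳ a)) (suc-injective eq))
... | n , h = suc n , cong step h

index : Atom → ℕ
index (a , b) = proj₁ (enumerate-onto (a ℕ.+ b) a b refl)

enumerate-index : ∀ x → enumerate (index x) ≡ x
enumerate-index (a , b) = proj₂ (enumerate-onto (a ℕ.+ b) a b refl)

skeleton : Formula → PropFormula
skeleton A = A ⟪ atom ∘ index ⟫

skeleton-⟪⟫ : ∀ A → skeleton A ⟪ atom ∘ enumerate ⟫ ≡ A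
skeleton-⟪⟫ (atom x) = cong atom (enumerate-index x)
skeleton-⟪⟫ (A ∨ B)  = cong₂ _∨_ (skeleton-⟪⟫ A) (skeleton-⟪⟫ B)
skeleton-⟪⟫ (∼ A)    = cong ∼_ (skeleton-⟪⟫ A)

-- `taut` takes schemes over ℕ only; numbering the atoms exhibits A as an instance of its own
-- skeleton.
⊢H-tautology : ∀ A → (∀ v → v ⊨ A) → ⊢H A
⊢H-tautology A h = subst ⊢H_ (skeleton-⟪⟫ A) (taut (skeleton A) (atom ∘ enumerate) λ v →
  trans (eval≡value v (skeleton A)) (trans (value-⟪⟫ v (atom ∘ index) A) (h (v ∘ index))))

⊢H-consequence : ∀ {A B C} → ⊢H A → ⊢H B → (∀ v → v ⊨ A → v ⊨ B → v ⊨ C) → ⊢H C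
⊢H-consequence {A} {B} {C} p q h = mp (mp (⊢H-tautology (A ⊃ B ⊃ C) λ v →
  ⊨-⊃ v A (B ⊃ C) λ a → ⊨-⊃ v B C (h v a)) p) q

⊢H-sound : ∀ {v A} → IsModel v → ⊢H A → v ⊨ A
⊢H-sound {v} m (taut P σ t) =
  trans (value-⟪⟫ v σ P) (trans (sym (eval≡value (value v ∘ σ) P)) (t (value v ∘ σ)))
⊢H-sound {v} m (ax₁ a b) = ⊨-⊃ v (ε a b) (ε a a) (εClosed.ε-refl m)
⊢H-sound {v} m (ax₂ a b c) with v (a , b) in ab | v (b , c) in bc
... | true  | true  = εClosed.ε-trans m ab bc
... | true  | false = refl
... | false | _     = refl
⊢H-sound {v} m (ax₃ a b) with v (a , b) in ab | v (b , b) in bb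
... | true  | true  = εClosed.ε-sym m ab bb
... | true  | false = refl
... | false | _     = refl
⊢H-sound {v} m (mp {A} {B} p q) = ⊨-mp v A B (⊢H-sound m p) (⊢H-sound m q)

-- Positive and negative parts

-- The value that a part of sign s takes when the whole formula is false.
refuted : Sign → Bool
refuted + = false
refuted - = true

part-value : ∀ {s v A B} → Part s A B → value v A ≡ false → value v B ≡ refuted s
part-value root   h = h
part-value (∨ˡ p) h = proj₁ (∨-false (part-value p h))
part-value {v = v} (∨ʳ {B = B} p) h = proj₂ (∨-false {value v B} (part-value p h))
part-value (∼⁺ p) h = not-injective (part-value p h)
part-value (∼⁻ p) h = not-injective (part-value p h)

part-weaken : ∀ {s A B C} → Part s A B → Part s (A ∨ C) B
part-weaken root   = ∨ˡ root
part-weaken (∨ˡ p) = ∨ˡ (part-weaken p)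
part-weaken (∨ʳ p) = ∨ʳ (part-weaken p)
part-weaken (∼⁺ p) = ∼⁺ (part-weaken p)
part-weaken (∼⁻ p) = ∼⁻ (part-weaken p)

-- No path leads further down from an atom. Hence two atomic occurrences can overlap only if their
-- atoms coincide, which is how `NonOverlapping` is checked.
⊒-atom : ∀ {A s t x C} {p : Part s A (atom x)} {q : Part t A C} → p ⊒ q → C ≡ atom x
⊒-atom ⊒-refl = refl
⊒-atom (⊒-∨ˡ r) with () ← ⊒-atom r
⊒-atom (⊒-∨ʳ r) with () ← ⊒-atom r
⊒-atom (⊒-∼⁺ r) with () ← ⊒-atom r
⊒-atom (⊒-∼⁻ r) with () ← ⊒-atom r

-- Soundness of tableaux

-- Each rule is read upwards: where A is false and the matching axiom holds, the added disjunct, or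
-- one of the two for `∨₋`, is false as well.
⊢T⇒⊢H : ∀ {A} → ⊢T A → ⊢H A
⊢T⇒⊢H {A} (leaf , B , p , q) = ⊢H-tautology A λ v →
  ¬-not λ h → true≢false (part-value {v = v} q h) (part-value {v = v} p h)
⊢T⇒⊢H {A} (∨₋ {B} {C} p t u , c , d) = ⊢H-consequence (⊢T⇒⊢H (t , c)) (⊢T⇒⊢H (u , d)) sound
  where
  sound : ∀ v → v ⊨ A ∨ ∼ B → v ⊨ A ∨ ∼ C → v ⊨ A
  sound v h k with value v A in e
  ... | true = refl
  ... | false with ∨-true (part-value {v = v} p e)
  ...   | inj₁ b = ⊥-elim (true≢false h (cong not b))
  ...   | inj₂ b = ⊥-elim (true≢false k (cong not b))
⊢T⇒⊢H {A} (ε₁ {a} {b} p t , c) = ⊢H-consequence (ax₁ a b) (⊢T⇒⊢H (t , c)) sound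
  where
  sound : ∀ v → v ⊨ ε a b ⊃ ε a a → v ⊨ A ∨ ∼ ε a a → v ⊨ A
  sound v h k with value v A in e
  ... | true = refl
  -- Since `ε a b` is true here, `h` makes `ε a a` true; then `k` becomes `false ≡ true`, which is
  -- also the goal.
  ... | false rewrite part-value {v = v} p e | h = k
⊢T⇒⊢H {A} (ε₂ {a} {b} {c} p q _ t , cl) = ⊢H-consequence (ax₂ a b c) (⊢T⇒⊢H (t , cl)) sound
  where
  sound : ∀ v → v ⊨ (ε a b ∧ ε b c) ⊃ ε a c → v ⊨ A ∨ ∼ ε a c → v ⊨ A
  sound v h k with value v A in e
  ... | true = refl
  ... | false rewrite part-value {v = v} p e | part-value {v = v} q e | h = k
⊢T⇒⊢H {A} (ε₃b {a} {b} p q _ t , cl) = ⊢H-consequence (ax₃ a b) (⊢T⇒⊢H (t , cl)) sound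
  where
  sound : ∀ v → v ⊨ (ε a b ∧ ε b b) ⊃ ε b a → v ⊨ A ∨ ∼ ε b a → v ⊨ A
  sound v h k with value v A in e
  ... | true = refl
  ... | false rewrite part-value {v = v} p e | part-value {v = v} q e | h = k

-- Soundness of tableaux in first-order structures.

module _ {ℓ} (M : Structure ℓ) where

  Holds : Formula → Set ℓ
  Holds A = Sat M [] (T A)

  -- Refuting a negation gives constructively only the double negation of its body. That is enough,
  -- since soundness always aims at a contradiction.
  Refuted : Sign → Formula → Set ℓ
  Refuted + A = ¬ Holds A
  Refuted - A = ¬ ¬ Holds A

  part-refuted : ∀ {s A B} → Part s A B → ¬ Holds A → Refuted s B
  part-refuted root   h = h
  part-refuted (∨ˡ p) h = part-refuted p h ∘ inj₁
  part-refuted (∨ʳ p) h = part-refuted p h ∘ inj₂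
  part-refuted (∼⁺ p) h = part-refuted p h
  part-refuted (∼⁻ p) h = λ b → part-refuted p h (λ nb → nb b)

  Holds-refl : ∀ a b → Holds (ε a b) → Holds (ε a a)
  Holds-refl _ _ ((d , ad , _) , u) = (d , ad , ad) , u

  Holds-trans : ∀ a b c → Holds (ε a b) → Holds (ε b c) → Holds (ε a c)
  Holds-trans a b c ((d , ad , bd) , u) ((e , be , ce) , w) =
    -- Uniqueness under b identifies the witness e with d.
    (d , ad , subst (Structure.⟦F_⟧ M c) (w e d (be , bd)) ce) , u

  Holds-sym : ∀ a b → Holds (ε a b) → Holds (ε b b) → Holds (ε b a)
  Holds-sym _ _ ((d , ad , bd) , _) (_ , w) = (d , bd , ad) , w

  extend-refuted : ∀ {X Y : Set ℓ} → ¬ ¬ (X ⊎ ¬ Y) → ¬ X → ¬ Y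
  extend-refuted k h b = k λ where
    (inj₁ a)  → h a
    (inj₂ nb) → nb b

  -- Validity of Hilbert theorems also passes through this, which spares a check of arbitrary
  -- tautologies in the type-valued semantics.
  ⊢T-sound : ∀ {A} → ⊢T A → ¬ ¬ Holds A
  ⊢T-sound (leaf , B , p , q) h = part-refuted q h (part-refuted p h)
  ⊢T-sound (∨₋ p t u , c , d) h = part-refuted p h
    [ extend-refuted (⊢T-sound (t , c)) h , extend-refuted (⊢T-sound (u , d)) h ]′
  ⊢T-sound (ε₁ {a} {b} p t , c) h = part-refuted p h λ ab →
    extend-refuted (⊢T-sound (t , c)) h (Holds-refl a b ab)
  ⊢T-sound (ε₂ {a} {b} {c} p q _ t , cl) h = part-refuted p h λ ab → part-refuted q h λ bc →
    extend-refuted (⊢T-sound (t , cl)) h (Holds-trans a b c ab bc)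
  ⊢T-sound (ε₃b {a} {b} p q _ t , cl) h = part-refuted p h λ ab → part-refuted q h λ bb →
    extend-refuted (⊢T-sound (t , cl)) h (Holds-sym a b ab bb)

-- Completeness of tableaux

infix 4 _∈?_

_∈?_ : (x : Atom) (N : List Atom) → Dec (x ∈ N)
_∈?_ = mem? (≡-dec _≟_ _≟_)

member : List Atom → Valuation
member N x = does (x ∈? N)

member⁺ : ∀ {N x} → x ∈ N → member N x ≡ true
member⁺ {N} {x} h with x ∈? N
... | yes _ = refl
... | no ¬h = ⊥-elim (¬h h)

member⁻ : ∀ {N x} → member N x ≡ true → x ∈ N
member⁻ {N} {x} h with x ∈? N
... | yes p = p

nonmember⁺ : ∀ {N x} → x ∉ N → member N x ≡ false
nonmember⁺ ¬h = ¬-not (¬h ∘ member⁻)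

member-model : ∀ {N} → εClosed (_∈ N) → IsModel (member N)
member-model c = record
  { ε-refl  = member⁺ ∘ ε-refl ∘ member⁻
  ; ε-trans = λ p q → member⁺ (ε-trans (member⁻ p) (member⁻ q))
  ; ε-sym   = λ p q → member⁺ (ε-sym (member⁻ p) (member⁻ q))
  } where open εClosed c

data Forced (N : List Atom) : Atom → Set where
  by-refl  : ∀ {a b} → (a , b) ∈ N → Forced N (a , a)
  by-trans : ∀ {a b c} → (a , b) ∈ N → (b , c) ∈ N → Forced N (a , c)
  by-sym   : ∀ {a b} → (a , b) ∈ N → (b , b) ∈ N → Forced N (b , a)

all-or : ∀ {A Q : Set} {P : A → Set} xs → (∀ {x} → x ∈ xs → P x ⊎ Q) → (∀ {x} → x ∈ xs → P x) ⊎ Q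
all-or [] h = inj₁ λ ()
all-or (x ∷ xs) h with h (here refl) | all-or xs (h ∘ there)
... | inj₂ q | _      = inj₂ q
... | inj₁ p | inj₂ q = inj₂ q
... | inj₁ p | inj₁ r = inj₁ λ where
  (here refl) → p
  (there i)   → r i

New : List Atom → Set
New N = ∃[ y ] Forced N y × y ∉ N

member-or-new : ∀ {N y} → Forced N y → y ∈ N ⊎ New N
member-or-new {N} {y} f with y ∈? N
... | yes i = inj₁ i
... | no ¬i = inj₂ (y , f , ¬i)

closed-or-new : ∀ N → εClosed (_∈ N) ⊎ New N
closed-or-new N with all-or N (member-or-new ∘ by-refl)
                   | all-or N (λ p → all-or N (transitive p))
                   | all-or N symmetric
  where
  -- The shared middle name is an equation, so that `all-or` can run over all pairs of entries.
  transitive : ∀ {x} → x ∈ N → ∀ {y} → y ∈ N → (proj₂ x ≡ proj₁ y → (proj₁ x , proj₂ y) ∈ N) ⊎ New N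
  transitive {a , b} p {c , d} q with b ≟ c
  ... | no b≢c = inj₁ (⊥-elim ∘ b≢c)
  ... | yes refl with member-or-new (by-trans p q)
  ...   | inj₁ i = inj₁ (const i)
  ...   | inj₂ n = inj₂ n
  symmetric : ∀ {x} → x ∈ N → ((proj₂ x , proj₂ x) ∈ N → (proj₂ x , proj₁ x) ∈ N) ⊎ New N
  symmetric {a , b} p with (b , b) ∈? N
  ... | no ¬q = inj₁ (⊥-elim ∘ ¬q)
  ... | yes q with member-or-new (by-sym p q)
  ...   | inj₁ i = inj₁ (const i)
  ...   | inj₂ n = inj₂ n
... | inj₂ n | _      | _      = inj₂ n
... | inj₁ _ | inj₂ n | _      = inj₂ n
... | inj₁ _ | inj₁ _ | inj₂ n = inj₂ n
... | inj₁ r | inj₁ t | inj₁ s = inj₁ (record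
  { ε-refl = r ; ε-trans = λ p q → t p q refl ; ε-sym = s })

Over : List Name → Atom → Set
Over ns (a , b) = a ∈ ns × b ∈ ns

forced-over : ∀ {ns N y} → (∀ {x} → x ∈ N → Over ns x) → Forced N y → Over ns y
forced-over h (by-refl p)    = proj₁ (h p) , proj₁ (h p)
forced-over h (by-trans p q) = proj₁ (h p) , proj₂ (h q)
forced-over h (by-sym p q)   = proj₂ (h p) , proj₁ (h p)

-- The occurrences used are distinct because otherwise y would already be in N.
apply-rule : ∀ {G N y} → (∀ {x} → x ∈ N → Part - G (atom x)) → Forced N y → y ∉ N →
             ⊢T (G ∨ ∼ atom y) → ⊢T G
apply-rule h (by-refl p) _ (t , c) = ε₁ (h p) t , c
apply-rule h (by-trans {a} {b} {c} p q) ∉N (t , cl) =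
  ε₂ (h p) (h q) ((λ r → distinct (⊒-atom r)) , λ r → distinct (sym (⊒-atom r))) t , cl
  where
  distinct : ¬ _≡_ {A = Formula} (ε b c) (ε a b)
  distinct refl = ∉N p
apply-rule h (by-sym {a} {b} p q) ∉N (t , cl) =
  ε₃b (h p) (h q) ((λ r → distinct (⊒-atom r)) , λ r → distinct (sym (⊒-atom r))) t , cl
  where
  distinct : ¬ _≡_ {A = Formula} (ε b b) (ε a b)
  distinct refl = ∉N p

Refutation : List Atom → List Atom → List Atom → Set
Refutation N P N′ = εClosed (_∈ N′) × N ⊆ N′ × (∀ {x} → x ∈ P → x ∉ N′)

∈-remove : ∀ {A : Set} {x y : A} ys {zs} → x ∈ ys ++ y ∷ zs → x ≡ y ⊎ x ∈ ys ++ zs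
∈-remove ys i with ∈-++⁻ ys i
... | inj₁ j          = inj₂ (∈-++⁺ˡ j)
... | inj₂ (here eq)  = inj₁ eq
... | inj₂ (there j)  = inj₂ (∈-++⁺ʳ ys j)

-- M lists the atoms over ns that may still be added to N; each rule
-- application moves one of them to N.
saturate : ∀ k ns M N P → length M ≡ k →
           (∀ {x} → x ∈ N → Over ns x) → (∀ {x} → Over ns x → x ∈ N ⊎ x ∈ M) →
           ∀ G → (∀ {x} → x ∈ N → Part - G (atom x)) → (∀ {x} → x ∈ P → Part + G (atom x)) →
           ⊢T G ⊎ ∃ (Refutation N P)
saturate k ns M N P len over cover G hN hP with closed-or-new N
... | inj₁ c with all-or P disjoint
  where
  disjoint : ∀ {x} → x ∈ P → x ∉ N ⊎ ⊢T G
  disjoint {x} p with x ∈? N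
  ... | yes q = inj₂ (leaf , atom x , hP p , hN q)
  ... | no ¬q = inj₁ ¬q
...   | inj₁ d = inj₂ (N , c , (λ i → i) , d)
...   | inj₂ t = inj₁ t
-- The rules introduce no names, so the forced atom y is covered; not being in N, it is in M.
saturate k ns M N P len over cover G hN hP | inj₂ (y , f , y∉N) with cover (forced-over over f)
... | inj₁ y∈N = ⊥-elim (y∉N y∈N)
... | inj₂ y∈M with ∈-∃++ y∈M
saturate zero ns M N P len over cover G hN hP | inj₂ _ | inj₂ _ | [] , zs , refl with () ← len
saturate zero ns M N P len over cover G hN hP | inj₂ _ | inj₂ _ | _ ∷ _ , zs , refl with () ← len
saturate (suc k) ns M N P len over cover G hN hP | inj₂ (y , f , y∉N) | inj₂ _ | ys , zs , refl
  with saturate k ns (ys ++ zs) (y ∷ N) P len′ over′ cover′ (G ∨ ∼ atom y) hN′ (part-weaken ∘ hP)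
  where
  len′ : length (ys ++ zs) ≡ k
  len′ = suc-injective (trans (cong suc (length-++ ys))
    (trans (sym (+-suc (length ys) (length zs))) (trans (sym (length-++ ys)) len)))
  over′ : ∀ {x} → x ∈ y ∷ N → Over ns x
  over′ (here refl) = forced-over over f
  over′ (there i)   = over i
  cover′ : ∀ {x} → Over ns x → x ∈ y ∷ N ⊎ x ∈ ys ++ zs
  cover′ o with cover o
  ... | inj₁ i = inj₁ (there i)
  ... | inj₂ i with ∈-remove ys i
  ...   | inj₁ refl = inj₁ (here refl)
  ...   | inj₂ j    = inj₂ j
  hN′ : ∀ {x} → x ∈ y ∷ N → Part - (G ∨ ∼ atom y) (atom x)
  hN′ (here refl) = ∼⁺ (∨ʳ root)
  hN′ (there i)   = part-weaken (hN i)
... | inj₁ t = inj₁ (apply-rule hN f y∉N t)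
... | inj₂ (N′ , c , sub , d) = inj₂ (N′ , c , sub ∘ there , d)

-- Decomposing parts down to atoms.

SignedFormula : Set
SignedFormula = Sign × Formula

PartOf : Formula → SignedFormula → Set
PartOf G (s , B) = Part s G B

RefutedBy : List Atom → SignedFormula → Set
RefutedBy N (s , B) = value (member N) B ≡ refuted s

-- Γ is the agenda of parts still to be decomposed; N and P hold the negative and positive atoms met
-- so far. G is quantified because the tableau formula grows.
Decided : List Atom → List Atom → List SignedFormula → Set
Decided N P Γ = ∀ G → (∀ {x} → x ∈ N → Part - G (atom x)) → (∀ {x} → x ∈ P → Part + G (atom x)) →
                All (PartOf G) Γ → ⊢T G ⊎ (∃[ N′ ] Refutation N P N′ × All (RefutedBy N′) Γ)

-- With the agenda empty only the ε-rules remain, and the pairs of names from N bound what they can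
-- add.
decided-[] : ∀ N P → Decided N P []
decided-[] N P G hN hP [] with saturate _ ns (cartesianProduct ns ns) N P refl
    (λ i → ∈-++⁺ˡ (∈-map⁺ proj₁ i) , ∈-++⁺ʳ (map proj₁ N) (∈-map⁺ proj₂ i))
    (λ (p , q) → inj₂ (∈-cartesianProduct⁺ p q)) G hN hP
  where ns = map proj₁ N ++ map proj₂ N
... | inj₁ t        = inj₁ t
... | inj₂ (N′ , r) = inj₂ (N′ , r , [])

-- Structural induction on B, with the rest of the agenda handled by the hypothesis. A positive
-- disjunction needs no rule: its disjuncts are already parts and are queued one after the other.
decided-∷ : ∀ s B Γ → (∀ N P → Decided N P Γ) → ∀ N P → Decided N P ((s , B) ∷ Γ)
decided-∷ + (atom x) Γ h N P G hN hP (p ∷ ps) with h N (x ∷ P) G hN hP′ ps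
  where
  hP′ : ∀ {y} → y ∈ x ∷ P → Part + G (atom y)
  hP′ (here refl) = p
  hP′ (there i)   = hP i
... | inj₁ t = inj₁ t
... | inj₂ (N′ , (c , sub , d) , r) =
  inj₂ (N′ , (c , sub , d ∘ there) , nonmember⁺ (d (here refl)) ∷ r)
decided-∷ - (atom x) Γ h N P G hN hP (p ∷ ps) with h (x ∷ N) P G hN′ hP ps
  where
  hN′ : ∀ {y} → y ∈ x ∷ N → Part - G (atom y)
  hN′ (here refl) = p
  hN′ (there i)   = hN i
... | inj₁ t = inj₁ t
... | inj₂ (N′ , (c , sub , d) , r) =
  inj₂ (N′ , (c , sub ∘ there , d) , member⁺ (sub (here refl)) ∷ r)
decided-∷ + (B ∨ C) Γ h N P G hN hP (p ∷ ps)
  with decided-∷ + B ((+ , C) ∷ Γ) (decided-∷ + C Γ h) N P G hN hP (∨ˡ p ∷ ∨ʳ p ∷ ps)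
... | inj₁ t = inj₁ t
... | inj₂ (N′ , r , b ∷ c ∷ rs) = inj₂ (N′ , r , cong₂ Bool._∨_ b c ∷ rs)
-- Only this case branches: two closed subtableaux combine by `∨₋`, and a refutation from either
-- branch refutes the disjunction's sign.
decided-∷ - (B ∨ C) Γ h N P G hN hP (p ∷ ps)
  with decided-∷ - B Γ h N P (G ∨ ∼ B) (part-weaken ∘ hN) (part-weaken ∘ hP)
         (∼⁺ (∨ʳ root) ∷ All.map part-weaken ps)
     | decided-∷ - C Γ h N P (G ∨ ∼ C) (part-weaken ∘ hN) (part-weaken ∘ hP)
         (∼⁺ (∨ʳ root) ∷ All.map part-weaken ps)
... | inj₁ (t , c) | inj₁ (u , d) = inj₁ (∨₋ p t u , c , d)
... | inj₂ (N′ , r , b ∷ rs) | _ = inj₂ (N′ , r , cong (Bool._∨ value (member N′) C) b ∷ rs)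
... | inj₁ _ | inj₂ (N′ , r , c ∷ rs) = inj₂ (N′ , r , ∨-trueʳ c ∷ rs)
decided-∷ + (∼ B) Γ h N P G hN hP (p ∷ ps)
  with decided-∷ - B Γ h N P G hN hP (∼⁺ p ∷ ps)
... | inj₁ t = inj₁ t
... | inj₂ (N′ , r , b ∷ rs) = inj₂ (N′ , r , cong not b ∷ rs)
decided-∷ - (∼ B) Γ h N P G hN hP (p ∷ ps)
  with decided-∷ + B Γ h N P G hN hP (∼⁻ p ∷ ps)
... | inj₁ t = inj₁ t
... | inj₂ (N′ , r , b ∷ rs) = inj₂ (N′ , r , cong not b ∷ rs)

FiniteCountermodel : Formula → Set
FiniteCountermodel A = ∃[ N ] εClosed (_∈ N) × value (member N) A ≡ false

Countermodel : Formula → Set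
Countermodel A = ∃[ v ] IsModel v × value v A ≡ false

⊢T-or-countermodel : ∀ A → ⊢T A ⊎ FiniteCountermodel A
⊢T-or-countermodel A with decided-∷ + A [] decided-[] [] [] A (λ ()) (λ ()) (root ∷ [])
... | inj₁ t                            = inj₁ t
... | inj₂ (N , (c , _ , _) , r ∷ []) = inj₂ (N , c , r)

countermodel : ∀ {A} → FiniteCountermodel A → Countermodel A
countermodel (N , c , f) = member N , member-model c , f

-- From valuations to structures

module _ {v : Valuation} (m : IsModel v) where
  open εClosed m

  -- If `ε c c` is true, the d with `ε d c` true are the names equivalent to c, so c is the least of
  -- its class.
  Least : Name → Set
  Least c = ∀ d → d < c → ¬ v (d , c) ≡ true

  least-representative : ∀ a → v (a , a) ≡ true →
                         ∃[ c ] v (c , a) ≡ true × v (a , c) ≡ true × Least c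
  least-representative = <-rec _ search
    where
    Rep : Name → Set
    Rep a = v (a , a) ≡ true → ∃[ c ] v (c , a) ≡ true × v (a , c) ≡ true × Least c
    search : ∀ a → (∀ {d} → d < a → Rep d) → Rep a
    search a rec aa with anyUpTo? (λ d → v (d , a) ≟ᵇ true) a
    ... | no none = a , aa , aa , λ d d<a da → none (d , d<a , da)
    ... | yes (d , d<a , da) with rec d<a (ε-refl da)
    ...   | c , cd , dc , least = c , ε-trans cd da , ε-trans (ε-sym da aa) dc , least

  module _ (ℓ : Level) where

    -- Instead of a quotient of the names, all of ℕ is kept and `Least` leaves one number per class,
    -- so identity can be literal equality.
    Falls : Name → ℕ ⊎ Bool → Set
    Falls a (inj₁ c) = v (c , a) ≡ true × Least c
    Falls a (inj₂ _) = v (a , a) ≡ false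

    structure : Structure ℓ
    structure = record
      { Domain   = Lift ℓ (ℕ ⊎ Bool)
      ; nonempty = lift (inj₂ true)
      ; ⟦F_⟧     = λ a d → Lift ℓ (Falls a (Lift.lower d))
      }

    -- Two numbers under a are both equivalent to a, hence to each other; were they distinct, the
    -- smaller would contradict leastness of the larger.
    falls-unique : ∀ a → v (a , a) ≡ true → ∀ d e → Falls a d → Falls a e → d ≡ e
    falls-unique a aa (inj₂ _) _ p _ = ⊥-elim (true≢false aa p)
    falls-unique a aa _ (inj₂ _) _ q = ⊥-elim (true≢false aa q)
    falls-unique a aa (inj₁ c) (inj₁ d) (ca , cl) (da , dl) with <-cmp c d
    ... | tri≈ _ refl _ = refl
    ... | tri< c<d _ _  = ⊥-elim (dl c c<d (ε-trans ca (ε-sym da aa)))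
    ... | tri> _ _ d<c  = ⊥-elim (cl d d<c (ε-trans da (ε-sym ca aa)))

    holds-ε⁺ : ∀ a b → v (a , b) ≡ true → Holds structure (ε a b)
    holds-ε⁺ a b ab with least-representative a (ε-refl ab)
    ... | c , ca , ac , least =
      (lift (inj₁ c) , lift (ca , least) , lift (ε-trans ca ab , least)) ,
      λ (lift d) (lift e) (lift p , lift q) → cong lift (falls-unique a (ε-refl ab) d e p q)

    holds-ε⁻ : ∀ a b → Holds structure (ε a b) → v (a , b) ≡ true
    holds-ε⁻ a b (w , u) with v (a , a) in aa
    -- Both extra objects fall under a, so the uniqueness clause would identify them.
    ... | false with () ← u (lift (inj₂ true)) (lift (inj₂ false)) (lift aa , lift aa)
    holds-ε⁻ a b ((lift (inj₂ _) , lift p , _) , _) | true = ⊥-elim (true≢false aa p)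
    holds-ε⁻ a b ((lift (inj₁ c) , lift (ca , _) , lift (cb , _)) , _) | true =
      ε-trans (ε-sym ca aa) cb

    holds⁺ : ∀ A → v ⊨ A → Holds structure A
    holds⁻ : ∀ A → value v A ≡ false → ¬ Holds structure A

    holds⁺ (ε a b) h = holds-ε⁺ a b h
    holds⁺ (A ∨ B) h with ∨-true h
    ... | inj₁ p = inj₁ (holds⁺ A p)
    ... | inj₂ p = inj₂ (holds⁺ B p)
    holds⁺ (∼ A) h = holds⁻ A (not-injective h)

    holds⁻ (ε a b) h s = true≢false (holds-ε⁻ a b s) h
    holds⁻ (A ∨ B) h (inj₁ s) = holds⁻ A (proj₁ (∨-false h)) s
    holds⁻ (A ∨ B) h (inj₂ s) = holds⁻ B (proj₂ (∨-false {value v A} h)) s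
    holds⁻ (∼ A) h ns = ns (holds⁺ A (not-injective h))

countermodel⇒invalid : ∀ ℓ A → Countermodel A → ¬ Valid ℓ (T A)
countermodel⇒invalid ℓ A (v , m , f) valid = valid (structure m ℓ) (holds⁻ m ℓ A f)

-- Literal disjunctions and rejection

negAtoms : Formula → List Atom
negAtoms (A ∨ B)    = negAtoms A ++ negAtoms B
negAtoms (∼ atom x) = [ x ]
negAtoms _          = []

-- The invariant along a path: positive parts remain literal disjunctions, so a negative part is
-- reached only through a negated atom, where the path ends.
LiteralPart : Formula → Sign → Formula → Set
LiteralPart D + X = LiteralDisjunction X × negAtoms X ⊆ negAtoms D
LiteralPart D - X = ∃[ x ] X ≡ atom x × x ∈ negAtoms D

literal-part : ∀ {D} → LiteralDisjunction D → ∀ {s X} → Part s D X → LiteralPart D s X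
literal-part l root = l , λ i → i
literal-part l (∨ˡ p) with literal-part l p
... | k ∨ _ , sub = k , sub ∘ ∈-++⁺ˡ
literal-part l (∨ʳ {B = B} p) with literal-part l p
... | _ ∨ k , sub = k , sub ∘ ∈-++⁺ʳ (negAtoms B)
literal-part l (∼⁺ p) with literal-part l p
... | neg , sub = _ , refl , sub (here refl)
literal-part l (∼⁻ p) with () ← proj₁ (proj₂ (literal-part l p))

negative-part⁻ : ∀ {D x} → LiteralDisjunction D → Part - D (atom x) → x ∈ negAtoms D
negative-part⁻ l p with literal-part l p
... | _ , refl , i = i

-- The ambient G stays fixed while the induction descends into D and lengthens the path.
negative-part⁺ : ∀ {G D x} → LiteralDisjunction D → Part + G D → x ∈ negAtoms D → Part - G (atom x)
negative-part⁺ neg p (here refl) = ∼⁺ p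
negative-part⁺ (_∨_ {A} l k) p i with ∈-++⁻ (negAtoms A) i
... | inj₁ j = negative-part⁺ l (∨ˡ p) j
... | inj₂ j = negative-part⁺ k (∨ʳ p) j

literals-false : ∀ {v D G} → LiteralDisjunction D → Part + G D →
                 (∀ {x} → Part + G (atom x) → v x ≡ false) →
                 (∀ {x} → Part - G (atom x) → v x ≡ true) → value v D ≡ false
literals-false pos p hp hn = hp p
literals-false neg p hp hn = cong not (hn (∼⁺ p))
literals-false (l ∨ k) p hp hn =
  cong₂ Bool._∨_ (literals-false l (∨ˡ p) hp hn) (literals-false k (∨ʳ p) hp hn)

-- The valuation true exactly on the negative atoms of A falsifies A, and adding
-- a positive atom that is not among them does not change this.
Hintikka-countermodel : ∀ {A a b} → Hintikka A → LiteralDisjunction A → ¬ Part - A (ε a b) →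
                        Countermodel (A ∨ ε a b)
Hintikka-countermodel {A} H l ∉A = member (negAtoms A) , member-model closed ,
  cong₂ Bool._∨_
    (literals-false l root
      (λ p → nonmember⁺ λ i → no-clash (_ , p , negative-part⁺ l root i))
      (λ p → member⁺ (negative-part⁻ l p)))
    (nonmember⁺ λ i → ∉A (negative-part⁺ l root i))
  where
  open Hintikka H
  from : ∀ {x} → Part - A (atom x) → x ∈ negAtoms A
  from = negative-part⁻ l
  to : ∀ {x} → x ∈ negAtoms A → Part - A (atom x)
  to = negative-part⁺ l root
  closed : εClosed (_∈ negAtoms A)
  closed = record
    { ε-refl  = from ∘ ε-refl ∘ to
    ; ε-trans = λ p q → from (ε-trans (to p) (to q))
    ; ε-sym   = λ p q → from (ε-sym (to p) (to q))
    }

⊣H-sound : ∀ {a₀ A} → a₀ ⊣H A → Countermodel A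
⊣H-sound rej⁺ = const false , record { ε-refl = λ p → p ; ε-trans = λ p _ → p ; ε-sym = λ p _ → p } , refl
⊣H-sound rej⁻ = const true , record { ε-refl = λ p → p ; ε-trans = λ p _ → p ; ε-sym = λ p _ → p } , refl
⊣H-sound (rej-⊃ {A} {B} p r) with ⊣H-sound r
... | v , m , f = v , m , ⊭-⊃ v A B (⊢H-sound m p) f
⊣H-sound (rej-σ {B} σ r) with ⊣H-sound r
-- The inferred witness is v composed with the renaming; closure survives because the ε-rules are
-- schematic in the names.
... | v , m , f = _ , record { ε-refl = ε-refl ; ε-trans = ε-trans ; ε-sym = ε-sym } ,
  trans (sym (value-⟪⟫ v _ B)) f
  where open εClosed m
⊣H-sound (rej-∨ H l _ ∉A) = Hintikka-countermodel H l ∉A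

-- Completeness of rejection.

⊣H-tautology : ∀ {a₀ A B} → (∀ w → value w B ≡ false → value w A ≡ false) → a₀ ⊣H B → a₀ ⊣H A
⊣H-tautology {A = A} {B} h = rej-⊃ (⊢H-tautology (A ⊃ B) λ w → ⊨-⊃ w A B λ a →
  ¬-not λ b → true≢false a (h w b))

-- A clash would give one formula two values under v, and the disjunction clause is vacuous as all
-- negative parts are atoms.
literal-Hintikka : ∀ {v D} → LiteralDisjunction D → εClosed (_∈ negAtoms D) → value v D ≡ false →
                   Hintikka D
literal-Hintikka {v} {D} l c f = record
  { no-clash = λ (_ , p , q) → true≢false (part-value {v = v} q f) (part-value {v = v} p f)
  ; ∨-neg    = no-disjunction
  ; ε-refl   = to ∘ ε-refl ∘ from
  ; ε-trans  = λ p q → to (ε-trans (from p) (from q))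
  ; ε-sym    = λ p q → to (ε-sym (from p) (from q))
  }
  where
  open εClosed c
  from : ∀ {x} → Part - D (atom x) → x ∈ negAtoms D
  from = negative-part⁻ l
  to : ∀ {x} → x ∈ negAtoms D → Part - D (atom x)
  to = negative-part⁺ l root
  no-disjunction : ∀ {B C} → Part - D (B ∨ C) → Part - D B ⊎ Part - D C
  no-disjunction p with () ← proj₁ (proj₂ (literal-part l p))

-- The first atom is separate because there is no empty disjunction.
negatives : Atom → List Atom → Formula
negatives x []       = ∼ atom x
negatives x (y ∷ ys) = ∼ atom x ∨ negatives y ys

negatives-literal : ∀ x xs → LiteralDisjunction (negatives x xs)
negatives-literal x []       = neg
negatives-literal x (y ∷ ys) = neg ∨ negatives-literal y ys

negAtoms-negatives : ∀ x xs → negAtoms (negatives x xs) ≡ x ∷ xs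
negAtoms-negatives x []       = refl
negAtoms-negatives x (y ∷ ys) = cong (x ∷_) (negAtoms-negatives y ys)

negatives-false : ∀ {v} x xs → (∀ {y} → y ∈ x ∷ xs → v y ≡ true) → value v (negatives x xs) ≡ false
negatives-false x []       h = cong not (h (here refl))
negatives-false x (y ∷ ys) h = cong₂ Bool._∨_ (cong not (h (here refl))) (negatives-false y ys (h ∘ there))

-- Renaming every name to `a₀` turns each disjunct into the rejected `∼ ε a₀ a₀`.
negatives-rejected : ∀ a₀ x xs → a₀ ⊣H negatives x xs
negatives-rejected a₀ x xs = rej-σ (const a₀) (⊣H-tautology (λ w f →
  trans (value-⟪⟫ w _ (negatives x xs)) (negatives-false x xs λ _ → not-injective f)) rej⁻)

-- A finite diagram in the sense of model theory, negated. `negAtoms-≡` and `refutable` are carried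
-- along because `rej-∨` asks for a Hintikka formula at every stage.
record Diagram (a₀ : Name) (N P : List Atom) : Set where
  field
    disjunction : Formula
    literal     : LiteralDisjunction disjunction
    negAtoms-≡  : negAtoms disjunction ≡ N
    refutable   : value (member N) disjunction ≡ false
    rejected    : a₀ ⊣H disjunction
    positive    : ∀ {w x} → value w disjunction ≡ false → x ∈ P → w x ≡ false

diagram : ∀ a₀ x xs P → εClosed (_∈ x ∷ xs) → All (_∉ x ∷ xs) P → Diagram a₀ (x ∷ xs) P
diagram a₀ x xs [] c [] = record
  { disjunction = negatives x xs
  ; literal     = negatives-literal x xs
  ; negAtoms-≡  = negAtoms-negatives x xs
  ; refutable   = negatives-false x xs member⁺
  ; rejected    = negatives-rejected a₀ x xs
  ; positive    = λ _ ()
  }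
diagram a₀ x xs (p ∷ P) c (p∉ ∷ P∉) = record
  { disjunction = disjunction ∨ atom p
  ; literal     = literal ∨ pos
  ; negAtoms-≡  = trans (++-identityʳ _) negAtoms-≡
  ; refutable   = cong₂ Bool._∨_ refutable (nonmember⁺ p∉)
  ; rejected    = rej-∨
      (literal-Hintikka literal (subst (λ N → εClosed (_∈ N)) (sym negAtoms-≡) c) refutable)
      literal rejected
      (λ q → p∉ (subst (p ∈_) negAtoms-≡ (negative-part⁻ literal q)))
  ; positive    = λ {w} f → λ where
      (here refl) → proj₂ (∨-false {value w disjunction} f)
      (there i)   → positive (proj₁ (∨-false f)) i
  }
  where open Diagram (diagram a₀ x xs P c P∉)

⊣H-complete : ∀ a₀ {A} → FiniteCountermodel A → a₀ ⊣H A
-- With N empty there is no negated disjunct to start from. But A is false when all atoms are, so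
-- after renaming to `a₀` it is false whenever `ε a₀ a₀` is.
⊣H-complete a₀ {A} ([] , _ , f) = rej-σ (const a₀) (⊣H-tautology (λ w g →
  trans (value-⟪⟫ w _ A) (trans (value-cong A λ _ → g) f)) rej⁺)
⊣H-complete a₀ {A} (N@(x ∷ xs) , c , f) = ⊣H-tautology implies rejected
  where
  outside : List Atom
  -- With these added, falsity of the disjunction fixes every atom of A.
  outside = filter (λ y → ¬? (y ∈? N)) (atoms A)
  open Diagram (diagram a₀ x xs outside c
    (All.tabulate λ i → proj₂ (∈-filter⁻ (λ y → ¬? (y ∈? N)) {xs = atoms A} i)))
  agree : ∀ {w} → value w disjunction ≡ false → ∀ {y} → y ∈ atoms A → w y ≡ member N y
  agree {w} g {y} i with y ∈? N
  ... | yes j = trans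
    (part-value {v = w} (negative-part⁺ literal root (subst (y ∈_) (sym negAtoms-≡) j)) g)
    (sym (member⁺ j))
  ... | no ¬j = trans (positive g (∈-filter⁺ (λ y → ¬? (y ∈? N)) i ¬j)) (sym (nonmember⁺ ¬j))
  implies : ∀ w → value w disjunction ≡ false → value w A ≡ false
  implies w g = trans (value-cong A (agree g)) f

-- The equivalences, from the choice between closed tableau and countermodel.

⊢H⇒⊢T : ∀ {A} → ⊢H A → ⊢T A
⊢H⇒⊢T {A} p with ⊢T-or-countermodel A
... | inj₁ t = t
... | inj₂ c with countermodel {A} c
...   | v , m , f = ⊥-elim (true≢false (⊢H-sound m p) f)

valid⇒⊢T : ∀ ℓ {A} → Valid ℓ (T A) → ⊢T A
valid⇒⊢T ℓ {A} valid with ⊢T-or-countermodel A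
... | inj₁ t = t
... | inj₂ c = ⊥-elim (countermodel⇒invalid ℓ A (countermodel {A} c) valid)

⊢T-unless-rejected : ∀ a₀ {A} → ¬ (a₀ ⊣H A) → ⊢T A
⊢T-unless-rejected a₀ {A} ¬r with ⊢T-or-countermodel A
... | inj₁ t = t
... | inj₂ c = ⊥-elim (¬r (⊣H-complete a₀ c))

theorem6p2 : (ℓ : Level) (a₀ : Name) (A : Formula) →
    ((⊢T A) ⇔ (⊢H A)) × ((⊢H A) ⇔ Valid ℓ (T A)) × (Valid ℓ (T A) ⇔ (¬ (a₀ ⊣H A)))
theorem6p2 ℓ a₀ A =
  mk⇔ ⊢T⇒⊢H ⊢H⇒⊢T ,
  mk⇔ (λ p M → ⊢T-sound M (⊢H⇒⊢T p)) (⊢T⇒⊢H ∘ valid⇒⊢T ℓ) ,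
  mk⇔ (λ valid r → countermodel⇒invalid ℓ A (⊣H-sound r) valid)
      (λ ¬r M → ⊢T-sound M (⊢T-unless-rejected a₀ ¬r))
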